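{- For every positive integer $r$ there exists $n_0(r)$ such that for all $n\ge n_0(r)$ the level $\mathscr{B}_r(n)$ is EKR; that is, the maximum size of an intersecting family $\mathcal{P}\subseteq\mathscr{B}_r(n)$ equals $\max_{p\in\mathscr{B}_1(n)}|\{q\in\mathscr{B}_r(n)\mid p\preceq q\}|$.
   Context: $\mathscr{B}(n)=(\mathrm{Sym}(n),\preceq)$ is the (right) weak Bruhat lattice. A permutation is written $p=p_1p_2\cdots p_n$, meaning $p(i)=p_i$. The order $\preceq$ is generated by the covering relation: $q$ covers $p$ if, for some $i\in\{1,\dots,n-1\}$, $p_i<p_{i+1}$, $q_i=p_{i+1}$, $q_{i+1}=p_i$ and $q_k=p_k$ for all other $k$. The least element is the identity, and rank is distance from the identity. $\mathscr{B}_\ell(n)$ is the set of all permutations of rank $\ell$ in $\mathscr{B}(n)$. A family $\mathcal{P}$ of permutations is intersecting if $\mathrm{rank}(x\wedge y)\ge 1$ for all $x,y\in\mathcal{P}$ (including $x=y$), where $\wedge$ is the meet in $\mathscr{B}(n)$. -}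

module Defs where

open import Data.Nat.Base using (ℕ; zero; suc; _≤_)
open import Data.Fin.Base using (Fin; toℕ; _<_)
open import Data.Fin.Permutation using (Permutation′; _⟨$⟩ʳ_; _≈_; id)
open import Data.List.Base using (List; length)
import Data.List.Membership.Setoid as Membership
import Data.List.Relation.Unary.Unique.Setoid as UniqueSetoid
open import Data.Product.Base using (∃-syntax; Σ-syntax; _×_)
open import Function.Bundles using (_⇔_)
open import Level using (0ℓ; Level)
open import Relation.Binary.Bundles using (Setoid)
open import Relation.Binary.Core using (Rel)
import Relation.Binary.Construct.On as On
open import Relation.Binary.Construct.Closure.ReflexiveTransitive using (Star)
open import Relation.Binary.Construct.Closure.Symmetric using (SymClosure)
open import Relation.Binary.Construct.Union using (_∪_)
open import Relation.Binary.PropositionalEquality using (_≡_; _≢_; _→-setoid_)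
open import Relation.Unary using (Pred; _∈_; _⊆_)

private
  variable
    n : ℕ

-- The letter pᵢ of the word p₁p₂⋯pₙ is p ⟨$⟩ʳ i, with positions and letters
-- numbered from 0.  Sym(n) is Permutation′ n with pointwise equality _≈_.

permSetoid : ℕ → Setoid 0ℓ 0ℓ
permSetoid n = On.setoid (Fin n →-setoid Fin n) (_⟨$⟩ʳ_ {n} {n})

infix 4 _⋖_ _⪯_

-- "q covers p": the letters at two consecutive positions i, j = i + 1, in
-- increasing order in p, are exchanged.

_⋖_ : Rel (Permutation′ n) 0ℓ
_⋖_ {n} p q = Σ[ i ∈ Fin n ] Σ[ j ∈ Fin n ]
    toℕ j ≡ suc (toℕ i)
  × p ⟨$⟩ʳ i < p ⟨$⟩ʳ j
  × q ⟨$⟩ʳ i ≡ p ⟨$⟩ʳ j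
  × q ⟨$⟩ʳ j ≡ p ⟨$⟩ʳ i
  × (∀ k → k ≢ i → k ≢ j → q ⟨$⟩ʳ k ≡ p ⟨$⟩ʳ k)

-- Star alone would be reflexive only for _≡_, which is finer than _≈_ on
-- Permutation′ n; including _≈_ as a step makes the order reflexive for _≈_.

_⪯_ : Rel (Permutation′ n) 0ℓ
_⪯_ = Star (_≈_ ∪ _⋖_)

-- Walks of a given length in the (undirected) Hasse diagram.

data Walk {n} : ℕ → Rel (Permutation′ n) 0ℓ where
  here : ∀ {p q} → p ≈ q → Walk zero p q
  step : ∀ {k p q s} → SymClosure _⋖_ p q → Walk k q s → Walk (suc k) p s

IsDistance : Permutation′ n → Permutation′ n → ℕ → Set
IsDistance p q k = Walk k p q × (∀ m → Walk m p q → k ≤ m)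

HasRank : Permutation′ n → ℕ → Set
HasRank p k = IsDistance id p k

Level⟨_⟩ : ℕ → Pred (Permutation′ n) 0ℓ
Level⟨ ℓ ⟩ p = HasRank p ℓ

IsMeet : Permutation′ n → Permutation′ n → Permutation′ n → Set
IsMeet x y m = m ⪯ x × m ⪯ y × (∀ z → z ⪯ x → z ⪯ y → z ⪯ m)

-- The weak order is a lattice, so exactly one m (up to _≈_) satisfies
-- IsMeet x y m; quantifying over it expresses rank (x ∧ y) ≥ 1 without a chosen
-- meet operation.

Intersecting : Pred (Permutation′ n) 0ℓ → Set
Intersecting P = ∀ x y → x ∈ P → y ∈ P →
  ∀ m → IsMeet x y m → ∃[ k ] HasRank m k × 1 ≤ k

-- P consists of exactly k permutations, counted up to _≈_.

HasSize : Pred (Permutation′ n) 0ℓ → ℕ → Set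
HasSize {n} P k = Σ[ xs ∈ List (Permutation′ n) ]
  Unique xs × (∀ q → (q ∈ P) ⇔ (q ∈ₗ xs)) × length xs ≡ k
  where
  open UniqueSetoid (permSetoid n) using (Unique)
  open Membership (permSetoid n) using () renaming (_∈_ to _∈ₗ_)

IsMaximum : {a : Level} → Pred ℕ a → ℕ → Set a
IsMaximum S N = N ∈ S × (∀ k → k ∈ S → k ≤ N)

IntersectingSize : (n r : ℕ) → Pred ℕ (Level.suc 0ℓ)
IntersectingSize n r k = Σ[ P ∈ Pred (Permutation′ n) 0ℓ ]
  P ⊆ Level⟨ r ⟩ × Intersecting P × HasSize P k

StarSize : (n r : ℕ) → Pred ℕ 0ℓ
StarSize n r k = Σ[ p ∈ Permutation′ n ]
  p ∈ Level⟨ 1 ⟩ × HasSize (λ q → q ∈ Level⟨ r ⟩ × p ⪯ q) k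

IsEKR : (n r : ℕ) → Set₁
IsEKR n r = ∃[ N ] IsMaximum (IntersectingSize n r) N × IsMaximum (StarSize n r) N

-- Write D(x) for the set of i such that the letter i + 1 precedes the letter i
-- in x; these are the atoms sᵢ below x, so x ∧ y has rank ≥ 1 iff D(x) and D(y)
-- meet.  Multiplying by sᵢ on the left toggles i ∈ D(x), changes the rank by
-- one, and for i ∈ D(x) keeps every other j ∈ D(x).  Let L k be the size of
-- level k.
-- If no i is common to all D(x) of an intersecting family of rank r, fix x₁ in
-- it and for each i some yᵢ with i ∉ D(yᵢ): every x has some i ∈ D(x₁) and some
-- j ∈ D(yᵢ), j ≠ i, in D(x), and is determined by i, j and sⱼsᵢx, so there are
-- at most r² L(r - 2) members.
-- The star of sᵢ in level r has the size of {x of rank r - 1 : i ∉ D(x)}, which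
-- is at least L(r - 1) - L(r - 2).  Counting pairs (x, i) with x of rank k and
-- i ∉ D(x) gives (n - 1 - k) L(k) ≤ (k + 1) L(k + 1), since |D(x)| ≤ rank x; so
-- L(r - 1) / L(r - 2) grows with n and the star wins.

module Submission where

open import Defs
open import Data.Fin.Base using (Fin; zero; suc; toℕ; inject₁; _<_)
open import Data.Fin.Permutation
  using (Permutation′; permutation; _⟨$⟩ʳ_; _⟨$⟩ˡ_; _≈_; id; flip; _∘ₚ_; inverseˡ; inverseʳ)
open import Data.Fin.Properties
  using (toℕ-injective; toℕ-inject₁; <-cmp; <-trans; <-irrefl; <-asym; _<?_; _≟_; any?; all?;
         injective⇒≤)
open import Data.List.Base
  using (List; []; _∷_; [_]; length; map; filter; lookup; allFin; concatMap; deduplicate;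
         cartesianProductWith)
open import Data.List.Properties using (length-map; length-++; length-tabulate)
import Data.List.Membership.Setoid as Membership
import Data.List.Membership.Setoid.Properties as ∈ₛ
import Data.List.Membership.Propositional as ∈ₚ
import Data.List.Membership.Propositional.Properties as ∈ₚ
open import Data.List.Relation.Unary.All as All using ([]; _∷_)
open import Data.List.Relation.Unary.All.Properties using (¬All⇒Any¬)
open import Data.List.Relation.Unary.Any as Any using (here; there)
open import Data.List.Relation.Unary.AllPairs using ([]; _∷_)
import Data.List.Relation.Unary.Unique.Setoid as UniqueSetoid
import Data.List.Relation.Unary.Unique.Setoid.Properties as !ₛ
import Data.List.Relation.Unary.Unique.DecSetoid.Properties as !ₛ
import Data.List.Relation.Unary.Unique.Propositional.Properties as !
open import Data.Bool.Base using (if_then_else_)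
open import Data.Nat.Base as ℕ using (ℕ; zero; suc; _+_; _*_; _∸_; _≤_; z≤n; s≤s; z<s; s<s)
open import Data.Nat.ListAction using () renaming (sum to sumₗ)
import Data.Nat.Properties as ℕ
open import Data.List.Extrema ℕ.≤-totalOrder using (argmax; f[xs]≤f[argmax])
open import Data.Product.Base as Product using (∃-syntax; _×_; _,_; proj₁; proj₂)
open import Data.Sum.Base using (_⊎_; inj₁; inj₂)
open import Function.Base using (_∘_)
open import Function.Bundles using (mk⇔; Equivalence)
open import Level using (Level; 0ℓ)
open import Relation.Binary.Bundles using (Setoid; DecSetoid)
open import Relation.Binary.Construct.Closure.ReflexiveTransitive using (ε; _◅_; _◅◅_)
open import Relation.Binary.Construct.Closure.Symmetric using (fwd; bwd)
open import Relation.Binary.Definitions using (tri<; tri≈; tri>)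
open import Relation.Binary.PropositionalEquality
  using (_≡_; _≢_; refl; sym; trans; cong; cong₂; setoid; subst; subst₂; module ≡-Reasoning)
open import Relation.Nullary using (¬_; Dec; yes; no; does; contradiction)
open import Relation.Nullary.Decidable using (dec-true; dec-false; does-⇔; _×-dec_; ¬?)
open import Relation.Unary using (Pred; Decidable)
open import Algebra.Properties.CommutativeSemigroup ℕ.+-commutativeSemigroup using (x∙yz≈y∙xz)
open import Algebra.Properties.CommutativeMonoid.Sum ℕ.+-0-commutativeMonoid
  using (sum; sum-cong-≗; sum-replicate-zero; ∑-comm; sum-permute)

private
  variable
    m n : ℕ

-- Adjacent transpositions

swap : Fin m → Fin (suc m) → Fin (suc m)
swap zero    zero          = suc zero
swap zero    (suc zero)    = zero
swap zero    (suc (suc k)) = suc (suc k)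
swap (suc i) zero          = zero
swap (suc i) (suc k)       = suc (swap i k)

swap-involutive : (i : Fin m) (k : Fin (suc m)) → swap i (swap i k) ≡ k
swap-involutive zero    zero          = refl
swap-involutive zero    (suc zero)    = refl
swap-involutive zero    (suc (suc k)) = refl
swap-involutive (suc i) zero          = refl
swap-involutive (suc i) (suc k)       = cong suc (swap-involutive i k)

swap-inject₁ : (i : Fin m) → swap i (inject₁ i) ≡ suc i
swap-inject₁ zero    = refl
swap-inject₁ (suc i) = cong suc (swap-inject₁ i)

swap-suc : (i : Fin m) → swap i (suc i) ≡ inject₁ i
swap-suc zero    = refl
swap-suc (suc i) = cong suc (swap-suc i)

swap-fixes : (i : Fin m) (k : Fin (suc m)) → k ≢ inject₁ i → k ≢ suc i → swap i k ≡ k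
swap-fixes zero    zero          k≢i k≢1+i = contradiction refl k≢i
swap-fixes zero    (suc zero)    k≢i k≢1+i = contradiction refl k≢1+i
swap-fixes zero    (suc (suc k)) k≢i k≢1+i = refl
swap-fixes (suc i) zero          k≢i k≢1+i = refl
swap-fixes (suc i) (suc k)       k≢i k≢1+i =
  cong suc (swap-fixes i k (k≢i ∘ cong suc) (k≢1+i ∘ cong suc))

-- An adjacent transposition has a single inversion. The inversion count, the persistence of
-- descents along covers and the renaming of chains all rest on this.
swap-mono-< : (i : Fin m) {a b : Fin (suc m)} → a < b →
              ¬ (a ≡ inject₁ i × b ≡ suc i) → swap i a < swap i b
swap-mono-< zero    {zero}        {suc zero}    a<b ≢ = contradiction (refl , refl) ≢
swap-mono-< zero    {zero}        {suc (suc b)} a<b ≢ = s<s z<s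
swap-mono-< zero    {suc zero}    {suc zero}    (s<s ()) ≢
swap-mono-< zero    {suc zero}    {suc (suc b)} a<b ≢ = z<s
swap-mono-< zero    {suc (suc a)} {suc zero}    (s<s ()) ≢
swap-mono-< zero    {suc (suc a)} {suc (suc b)} a<b ≢ = a<b
swap-mono-< (suc i) {zero}        {suc b}       a<b ≢ = z<s
swap-mono-< (suc i) {suc a}       {suc b}       (s<s a<b) ≢ =
  s<s (swap-mono-< i a<b λ (a≡ , b≡) → ≢ (cong suc a≡ , cong suc b≡))

inject₁<suc : (i : Fin m) → inject₁ i < suc i
inject₁<suc i = ℕ.s≤s (ℕ.≤-reflexive (toℕ-inject₁ i))

inject₁≢suc : (i : Fin m) → inject₁ i ≢ suc i
inject₁≢suc i eq = <-irrefl eq (inject₁<suc i)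

adj : Fin m → Permutation′ (suc m)
adj i = permutation (swap i) (swap i) (swap-involutive i) (swap-involutive i)

-- Descents are those of the inverse word: Descent i p means i ∈ D(p), whereas a
-- descent in position i of the word p is a Descent i (flip p).

Descent : Fin m → Permutation′ (suc m) → Set
Descent i p = p ⟨$⟩ˡ suc i < p ⟨$⟩ˡ inject₁ i

Ascent : Fin m → Permutation′ (suc m) → Set
Ascent i p = p ⟨$⟩ˡ inject₁ i < p ⟨$⟩ˡ suc i

≈-sym : {p q : Permutation′ n} → p ≈ q → q ≈ p
≈-sym p≈q i = sym (p≈q i)

ʳ-injective : (p : Permutation′ n) {i j : Fin n} → p ⟨$⟩ʳ i ≡ p ⟨$⟩ʳ j → i ≡ j
ʳ-injective p eq = trans (sym (inverseˡ p)) (trans (cong (p ⟨$⟩ˡ_) eq) (inverseˡ p))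

flip-cong : (p q : Permutation′ n) → p ≈ q → flip p ≈ flip q
flip-cong p q p≈q a = begin
  p ⟨$⟩ˡ a                       ≡⟨ cong (p ⟨$⟩ˡ_) (inverseʳ q) ⟨
  p ⟨$⟩ˡ (q ⟨$⟩ʳ (q ⟨$⟩ˡ a))     ≡⟨ cong (p ⟨$⟩ˡ_) (p≈q _) ⟨
  p ⟨$⟩ˡ (p ⟨$⟩ʳ (q ⟨$⟩ˡ a))     ≡⟨ inverseˡ p ⟩
  q ⟨$⟩ˡ a                       ∎
  where open ≡-Reasoning

Descent-resp : (i : Fin m) {p q : Permutation′ (suc m)} → p ≈ q → Descent i p → Descent i q
Descent-resp i {p} {q} p≈q = subst₂ _<_ (flip-cong p q p≈q _) (flip-cong p q p≈q _)

Descent? : (i : Fin m) (p : Permutation′ (suc m)) → Dec (Descent i p)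
Descent? i p = _ <? _

¬Descent⇒Ascent : (i : Fin m) (p : Permutation′ (suc m)) → ¬ Descent i p → Ascent i p
¬Descent⇒Ascent i p ¬d with <-cmp (p ⟨$⟩ˡ inject₁ i) (p ⟨$⟩ˡ suc i)
... | tri< a _ _ = a
... | tri≈ _ e _ = contradiction (ʳ-injective (flip p) e) (inject₁≢suc i)
... | tri> _ _ d = contradiction d ¬d

-- Left multiplication by adjacent transpositions

∘adj-involutive : (i : Fin m) (p : Permutation′ (suc m)) → (p ∘ₚ adj i) ∘ₚ adj i ≈ p
∘adj-involutive i p k = swap-involutive i (p ⟨$⟩ʳ k)

∘adj-cong : (i : Fin m) (p q : Permutation′ (suc m)) → p ≈ q → p ∘ₚ adj i ≈ q ∘ₚ adj i
∘adj-cong i p q p≈q k = cong (swap i) (p≈q k)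

∘adj-Ascent : (i : Fin m) (p : Permutation′ (suc m)) → Descent i p → Ascent i (p ∘ₚ adj i)
∘adj-Ascent i p d rewrite swap-inject₁ i | swap-suc i = d

∘adj-Descent : (i : Fin m) (p : Permutation′ (suc m)) → Ascent i p → Descent i (p ∘ₚ adj i)
∘adj-Descent i p a rewrite swap-inject₁ i | swap-suc i = a

-- Exchanging the letters at a descent `i` moves only the letter i to the left and only i + 1 to the
-- right. For `j` other than `i`, the letter j + 1 does not move right and j does not move left, so
-- their order survives even when one of them is i or i + 1.
∘adj-preserves-Descent : (i j : Fin m) (p : Permutation′ (suc m)) → i ≢ j →
                         Descent i p → Descent j p → Descent j (p ∘ₚ adj i)
∘adj-preserves-Descent i j p i≢j di dj =
  ℕ.≤-<-trans (down (i≢j ∘ sym ∘ suc-inj)) (ℕ.<-≤-trans dj (up (i≢j ∘ sym ∘ inject₁-inj)))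
  where
  pos : Fin _ → ℕ
  pos a = toℕ (p ⟨$⟩ˡ a)
  suc-inj : suc j ≡ suc i → j ≡ i
  suc-inj refl = refl
  inject₁-inj : inject₁ j ≡ inject₁ i → j ≡ i
  inject₁-inj eq = toℕ-injective (trans (sym (toℕ-inject₁ j)) (trans (cong toℕ eq) (toℕ-inject₁ i)))
  down : ∀ {b} → b ≢ suc i → pos (swap i b) ≤ pos b
  down {b} b≢ with b ≟ inject₁ i
  ... | yes refl rewrite swap-inject₁ i = ℕ.<⇒≤ di
  ... | no b≢′ = ℕ.≤-reflexive (cong pos (swap-fixes i b b≢′ b≢))
  up : ∀ {b} → b ≢ inject₁ i → pos b ≤ pos (swap i b)
  up {b} b≢ with b ≟ suc i
  ... | yes refl rewrite swap-suc i = ℕ.<⇒≤ di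
  ... | no b≢′ = ℕ.≤-reflexive (cong pos (sym (swap-fixes i b b≢ b≢′)))

≤-increasing : (f : Fin (suc m) → Fin n) → (∀ i → f (inject₁ i) < f (suc i)) →
               ∀ i → toℕ i ≤ toℕ (f i)
≤-increasing f inc zero = z≤n
≤-increasing {suc m} f inc (suc i) =
  ℕ.≤-trans (s≤s (≤-increasing (f ∘ inject₁) (inc ∘ inject₁) i)) (inc i)

increasing⇒strictMono : (f : Fin (suc m) → Fin n) → (∀ i → f (inject₁ i) < f (suc i)) →
                        ∀ {i j} → i < j → f i < f j
increasing⇒strictMono {suc m} f inc {zero} {suc zero} _ = inc zero
increasing⇒strictMono {suc m} f inc {zero} {suc (suc j)} _ =
  <-trans (inc zero) (increasing⇒strictMono (f ∘ suc) (inc ∘ suc) {zero} {suc j} z<s)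
increasing⇒strictMono {suc m} f inc {suc i} {suc j} (s<s i<j) =
  increasing⇒strictMono (f ∘ suc) (inc ∘ suc) i<j

-- Without descents the inverse is increasing, and hence so is `p`. An increasing map never falls
-- below the identity; applied to both, this gives the two inequalities.
noDescent⇒id : (p : Permutation′ (suc m)) → (∀ i → ¬ Descent i p) → p ≈ id
noDescent⇒id p ¬d i = toℕ-injective (ℕ.≤-antisym
  (subst (λ k → toℕ (p ⟨$⟩ʳ i) ≤ toℕ k) (inverseˡ p) (≤-increasing (p ⟨$⟩ˡ_) inc _))
  (≤-increasing (p ⟨$⟩ʳ_) (λ j → inc′ (inject₁<suc j)) i))
  where
  inc : ∀ i → Ascent i p
  inc i = ¬Descent⇒Ascent i p (¬d i)
  inc′ : ∀ {a b} → a < b → p ⟨$⟩ʳ a < p ⟨$⟩ʳ b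
  inc′ {a} {b} a<b with <-cmp (p ⟨$⟩ʳ a) (p ⟨$⟩ʳ b)
  ... | tri< x _ _ = x
  ... | tri≈ _ e _ = contradiction a<b (<-irrefl (ʳ-injective p e))
  ... | tri> _ _ x = contradiction
    (subst₂ _<_ (inverseˡ p) (inverseˡ p) (increasing⇒strictMono (p ⟨$⟩ˡ_) inc x)) (<-asym a<b)

-- The number of inversions

-- Opaque, so that unification can recover the arguments of inversion.
opaque
  inversion : (Fin n → Fin n) → Fin n → Fin n → ℕ
  inversion f i j = if does (i <? j ×-dec f j <? f i) then 1 else 0

  inversion-cong : {f g : Fin n → Fin n} {i j k l : Fin n} →
                   (i < j × f j < f i → k < l × g l < g k) →
                   (k < l × g l < g k → i < j × f j < f i) →
                   inversion f i j ≡ inversion g k l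
  inversion-cong to from =
    cong (if_then 1 else 0) (does-⇔ (mk⇔ to from) (_ <? _ ×-dec _ <? _) (_ <? _ ×-dec _ <? _))

  inversion≡0 : (f : Fin n → Fin n) (i j : Fin n) → ¬ (i < j × f j < f i) → inversion f i j ≡ 0
  inversion≡0 f i j ¬inv = cong (if_then 1 else 0) (dec-false (i <? j ×-dec f j <? f i) ¬inv)

  inversion≡1 : (f : Fin n → Fin n) (i j : Fin n) → i < j → f j < f i → inversion f i j ≡ 1
  inversion≡1 f i j i<j fj<fi = cong (if_then 1 else 0) (dec-true (i <? j ×-dec f j <? f i) (i<j , fj<fi))

-- The condition `i < j` sits inside `inversion`, so both sums run over all of `Fin n` and can be
-- reindexed by a permutation and interchanged.
inv : Permutation′ n → ℕ
inv p = sum λ i → sum λ j → inversion (p ⟨$⟩ʳ_) i j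

inv-cong : (p q : Permutation′ n) → p ≈ q → inv p ≡ inv q
inv-cong p q p≈q = sum-cong-≗ λ i → sum-cong-≗ λ j → inversion-cong
  (λ (i<j , x) → i<j , subst₂ _<_ (p≈q j) (p≈q i) x)
  (λ (i<j , x) → i<j , subst₂ _<_ (sym (p≈q j)) (sym (p≈q i)) x)

inv-id : inv (id {n}) ≡ 0
inv-id {n} = trans
  (sum-cong-≗ {n} λ i → trans
    (sum-cong-≗ {n} λ j → inversion≡0 (λ k → k) i j λ (i<j , j<i) → <-asym i<j j<i)
    (sum-replicate-zero n))
  (sum-replicate-zero n)

-- Positions and letters exchange roles: an inversion of `p` at two positions is an inversion of the
-- inverse at the letters found there. This links covers, which exchange positions, with descents,
-- which concern letters.
inv-flip : (p : Permutation′ n) → inv (flip p) ≡ inv p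
inv-flip {n} p = begin
  inv (flip p)
    ≡⟨ sum-permute {n} {n} _ p ⟩
  sum (λ i → sum λ b → inversion (p ⟨$⟩ˡ_) (p ⟨$⟩ʳ i) b)
    ≡⟨ sum-cong-≗ {n} (λ i → sum-permute {n} {n} _ p) ⟩
  sum (λ i → sum λ j → inversion (p ⟨$⟩ˡ_) (p ⟨$⟩ʳ i) (p ⟨$⟩ʳ j))
    ≡⟨ sum-cong-≗ {n} (λ i → sum-cong-≗ {n} λ j → swapped i j) ⟩
  sum (λ i → sum λ j → inversion (p ⟨$⟩ʳ_) j i)
    ≡⟨ ∑-comm {n} {n} _ ⟩
  inv p ∎
  where
  open ≡-Reasoning
  swapped : ∀ i j → inversion (p ⟨$⟩ˡ_) (p ⟨$⟩ʳ i) (p ⟨$⟩ʳ j) ≡ inversion (p ⟨$⟩ʳ_) j i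
  swapped i j = inversion-cong
    (λ (x , j<i) → subst₂ _<_ (inverseˡ p) (inverseˡ p) j<i , x)
    (λ (j<i , x) → x , subst₂ _<_ (sym (inverseˡ p)) (sym (inverseˡ p)) j<i)

sum-suc : (f g : Fin n → ℕ) (k : Fin n) → f k ≡ suc (g k) → (∀ i → i ≢ k → f i ≡ g i) →
          sum f ≡ suc (sum g)
sum-suc f g zero    fk rest = cong₂ _+_ fk (sum-cong-≗ λ i → rest (suc i) λ ())
sum-suc f g (suc k) fk rest = begin
  f zero + sum (f ∘ suc)
    ≡⟨ cong₂ _+_ (rest zero λ ())
         (sum-suc (f ∘ suc) (g ∘ suc) k fk λ i i≢k → rest (suc i) λ { refl → i≢k refl }) ⟩
  g zero + suc (sum (g ∘ suc)) ≡⟨ ℕ.+-suc _ _ ⟩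
  suc (g zero + sum (g ∘ suc)) ∎
  where open ≡-Reasoning

-- The only pair of positions whose order is affected is that of the letters i and i + 1.
inv-∘adj : (i : Fin m) (p : Permutation′ (suc m)) → Ascent i p → inv (p ∘ₚ adj i) ≡ suc (inv p)
inv-∘adj i p u<v =
  sum-suc _ _ u
    (sum-suc _ _ v at-uv λ b b≢v → elsewhere u b (b≢v ∘ proj₂))
    λ a a≢u → sum-cong-≗ λ b → elsewhere a b (a≢u ∘ proj₁)
  where
  u = p ⟨$⟩ˡ inject₁ i
  v = p ⟨$⟩ˡ suc i
  P = p ⟨$⟩ʳ_
  Q = (p ∘ₚ adj i) ⟨$⟩ʳ_
  u-unique : ∀ {a} → P a ≡ inject₁ i → a ≡ u
  u-unique e = trans (sym (inverseˡ p)) (cong (p ⟨$⟩ˡ_) e)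
  v-unique : ∀ {a} → P a ≡ suc i → a ≡ v
  v-unique e = trans (sym (inverseˡ p)) (cong (p ⟨$⟩ˡ_) e)
  at-uv : inversion Q u v ≡ suc (inversion P u v)
  at-uv = trans
    (inversion≡1 Q u v u<v (subst₂ _<_ (sym Qv) (sym Qu) (inject₁<suc i)))
    (cong suc (sym (inversion≡0 P u v λ (_ , Pv<Pu) →
      <-asym (inject₁<suc i) (subst₂ _<_ (inverseʳ p) (inverseʳ p) Pv<Pu))))
    where
    Qu : Q u ≡ suc i
    Qu = trans (cong (swap i) (inverseʳ p)) (swap-inject₁ i)
    Qv : Q v ≡ inject₁ i
    Qv = trans (cong (swap i) (inverseʳ p)) (swap-suc i)
  elsewhere : ∀ a b → ¬ (a ≡ u × b ≡ v) → inversion Q a b ≡ inversion P a b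
  elsewhere a b ≢uv = inversion-cong
    (λ (a<b , Qb<Qa) → a<b ,
      subst₂ _<_ (swap-involutive i (P b)) (swap-involutive i (P a)) (swap-mono-< i Qb<Qa λ (eb , ea) →
        ≢uv (u-unique (trans (sym (swap-involutive i (P a))) (trans (cong (swap i) ea) (swap-suc i)))
           , v-unique (trans (sym (swap-involutive i (P b))) (trans (cong (swap i) eb) (swap-inject₁ i))))))
    (λ (a<b , Pb<Pa) → a<b ,
      swap-mono-< i Pb<Pa λ (eb , ea) →
        <-asym a<b (subst₂ _<_ (sym (u-unique eb)) (sym (v-unique ea)) u<v))

inv-Descent : (i : Fin m) (p : Permutation′ (suc m)) → Descent i p → inv p ≡ suc (inv (p ∘ₚ adj i))
inv-Descent i p d = trans (sym (inv-cong ((p ∘ₚ adj i) ∘ₚ adj i) p (∘adj-involutive i p)))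
  (inv-∘adj i (p ∘ₚ adj i) (∘adj-Ascent i p d))

Descent⇒inv-pred : (i : Fin m) (p : Permutation′ (suc m)) {k : ℕ} → Descent i p →
                   inv p ≡ suc k → inv (p ∘ₚ adj i) ≡ k
Descent⇒inv-pred i p d eq = ℕ.suc-injective (trans (sym (inv-Descent i p d)) eq)

inv-adj : (i : Fin m) → inv (adj i) ≡ 1
inv-adj i = trans (inv-∘adj i id (inject₁<suc i)) (cong suc inv-id)

≈id⊎Descent : (p : Permutation′ (suc m)) → p ≈ id ⊎ ∃[ i ] Descent i p
≈id⊎Descent p with any? (λ i → Descent? i p)
... | yes d = inj₂ d
... | no ¬d = inj₁ (noDescent⇒id p λ i d → ¬d (i , d))

inv≡0⇒≈id : (p : Permutation′ (suc m)) → inv p ≡ 0 → p ≈ id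
inv≡0⇒≈id p eq with ≈id⊎Descent p
... | inj₁ p≈id = p≈id
... | inj₂ (i , d) = contradiction (trans (sym eq) (inv-Descent i p d)) λ ()

inv≡suc⇒Descent : (p : Permutation′ (suc m)) {k : ℕ} → inv p ≡ suc k → ∃[ i ] Descent i p
inv≡suc⇒Descent p eq with ≈id⊎Descent p
... | inj₁ p≈id = contradiction (trans (sym eq) (trans (inv-cong p id p≈id) inv-id)) λ ()
... | inj₂ d = d

-- The weak order

consecutive : (i j : Fin (suc m)) → toℕ j ≡ suc (toℕ i) → ∃[ k ] i ≡ inject₁ k × j ≡ suc k
consecutive i (suc k) eq =
  k , toℕ-injective (trans (sym (ℕ.suc-injective eq)) (sym (toℕ-inject₁ k))) , refl

-- A cover multiplies on the side of positions, so the ascent it requires is one of `flip p`.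
⋖⇒adj : (p q : Permutation′ (suc m)) → p ⋖ q → ∃[ k ] Ascent k (flip p) × q ≈ adj k ∘ₚ p
⋖⇒adj p q (i , j , eq , lt , qi , qj , rest) with consecutive i j eq
... | k , refl , refl = k , lt , q≈
  where
  q≈ : q ≈ adj k ∘ₚ p
  q≈ l with l ≟ inject₁ k | l ≟ suc k
  ... | yes refl | _ = trans qi (cong (p ⟨$⟩ʳ_) (sym (swap-inject₁ k)))
  ... | no _ | yes refl = trans qj (cong (p ⟨$⟩ʳ_) (sym (swap-suc k)))
  ... | no l≢i | no l≢j = trans (rest l l≢i l≢j) (cong (p ⟨$⟩ʳ_) (sym (swap-fixes k l l≢i l≢j)))

adj⇒⋖ : (k : Fin m) (p q : Permutation′ (suc m)) → Ascent k (flip p) → q ≈ adj k ∘ₚ p → p ⋖ q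
adj⇒⋖ k p q a q≈ =
  inject₁ k , suc k , cong suc (sym (toℕ-inject₁ k)) , a ,
  trans (q≈ _) (cong (p ⟨$⟩ʳ_) (swap-inject₁ k)) ,
  trans (q≈ _) (cong (p ⟨$⟩ʳ_) (swap-suc k)) ,
  λ l l≢i l≢j → trans (q≈ l) (cong (p ⟨$⟩ʳ_) (swap-fixes k l l≢i l≢j))

inv-⋖ : (p q : Permutation′ (suc m)) → p ⋖ q → inv q ≡ suc (inv p)
inv-⋖ p q p⋖q with ⋖⇒adj p q p⋖q
... | k , a , q≈ = begin
  inv q                ≡⟨ inv-cong q (adj k ∘ₚ p) q≈ ⟩
  inv (adj k ∘ₚ p)     ≡⟨ inv-flip (adj k ∘ₚ p) ⟨
  inv (flip p ∘ₚ adj k) ≡⟨ inv-∘adj k (flip p) a ⟩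
  suc (inv (flip p))   ≡⟨ cong suc (inv-flip p) ⟩
  suc (inv p)          ∎
  where open ≡-Reasoning

-- A cover exchanges two adjacent positions holding increasing letters. It could undo the descent
-- `i` only if those letters were i + 1 followed by i, a decreasing pair.
⋖-Descent : (i : Fin m) (p q : Permutation′ (suc m)) → p ⋖ q → Descent i p → Descent i q
⋖-Descent i p q p⋖q d with ⋖⇒adj p q p⋖q
... | k , a , q≈ = subst₂ _<_
  (sym (flip-cong q (adj k ∘ₚ p) q≈ _)) (sym (flip-cong q (adj k ∘ₚ p) q≈ _))
  (swap-mono-< k d λ (e₁ , e₂) → <-asym (inject₁<suc i) (subst₂ _<_
    (trans (cong (p ⟨$⟩ʳ_) (sym e₁)) (inverseʳ p))
    (trans (cong (p ⟨$⟩ʳ_) (sym e₂)) (inverseʳ p)) a))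

⪯-Descent : (i : Fin m) {p q : Permutation′ (suc m)} → p ⪯ q → Descent i p → Descent i q
⪯-Descent i ε d = d
⪯-Descent i {p} (_◅_ {j = s} (inj₁ p≈s) s⪯q) d = ⪯-Descent i s⪯q (Descent-resp i {p} {s} p≈s d)
⪯-Descent i {p} (_◅_ {j = s} (inj₂ p⋖s) s⪯q) d = ⪯-Descent i s⪯q (⋖-Descent i p s p⋖s d)

≈⇒⪯ : (p q : Permutation′ n) → p ≈ q → p ⪯ q
≈⇒⪯ p q p≈q = inj₁ p≈q ◅ ε

⋖-respˡ-≈ : (p q s : Permutation′ (suc m)) → p ≈ q → q ⋖ s → p ⋖ s
⋖-respˡ-≈ p q s p≈q q⋖s with ⋖⇒adj q s q⋖s
... | k , a , s≈ =
  adj⇒⋖ k p s (subst₂ _<_ (sym (p≈q _)) (sym (p≈q _)) a) λ l → trans (s≈ l) (sym (p≈q _))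

-- Walks and rank

Walk-snoc : {k : ℕ} {p q s : Permutation′ (suc m)} → Walk k p q → q ⋖ s → Walk (suc k) p s
Walk-snoc {p = p} {q} {s} (here p≈q) q⋖s =
  step (fwd (⋖-respˡ-≈ p q s p≈q q⋖s)) (here {p = s} {s} λ _ → refl)
Walk-snoc (step e w) q⋖s = step e (Walk-snoc w q⋖s)

-- Every edge of the Hasse diagram changes `inv` by exactly one, up or down. For walks from the
-- identity this is the lower bound on the distance.
Walk-inv : {k : ℕ} {p q : Permutation′ (suc m)} → Walk k p q → inv q ≤ k + inv p
Walk-inv {p = p} {q} (here p≈q) = ℕ.≤-reflexive (sym (inv-cong p q p≈q))
Walk-inv {k = suc k} {p} {q} (step {q = s} (fwd p⋖s) w) =
  subst (inv q ≤_) (trans (cong (k +_) (inv-⋖ p s p⋖s)) (ℕ.+-suc k _)) (Walk-inv w)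
Walk-inv {k = suc k} {p} {q} (step {q = s} (bwd s⋖p) w) = ℕ.≤-trans (Walk-inv w)
  (ℕ.≤-trans (ℕ.+-monoʳ-≤ k
    (ℕ.≤-trans (ℕ.n≤1+n _) (ℕ.≤-reflexive (sym (inv-⋖ s p s⋖p))))) (ℕ.n≤1+n _))

-- Descents of `flip p` are the descents of the word by position, and undoing one gives an element
-- covered by `p`. The resulting path is recorded both as a walk, for the rank, and as a chain, for
-- the order.
id-to : (k : ℕ) (p : Permutation′ (suc m)) → inv p ≡ k → Walk k id p × id ⪯ p
id-to zero p eq = here (≈-sym {p = p} {id} p≈id) , ≈⇒⪯ id p (≈-sym {p = p} {id} p≈id)
  where
  p≈id = inv≡0⇒≈id p eq
id-to (suc k) p eq with inv≡suc⇒Descent (flip p) (trans (inv-flip p) eq)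
... | i , d = Walk-snoc (proj₁ rec) p′⋖p , proj₂ rec ◅◅ (inj₂ p′⋖p ◅ ε)
  where
  p′ = adj i ∘ₚ p
  p′⋖p : p′ ⋖ p
  p′⋖p = adj⇒⋖ i p′ p (∘adj-Ascent i (flip p) d) λ l → cong (p ⟨$⟩ʳ_) (sym (swap-involutive i l))
  rec = id-to k p′ (ℕ.suc-injective (trans (sym (inv-⋖ p′ p p′⋖p)) eq))

id⪯ : (p : Permutation′ (suc m)) → id ⪯ p
id⪯ p = proj₂ (id-to (inv p) p refl)

HasRank-inv : (p : Permutation′ (suc m)) → HasRank p (inv p)
HasRank-inv p = proj₁ (id-to (inv p) p refl) ,
  λ k w → subst (inv p ≤_) (trans (cong (k +_) inv-id) (ℕ.+-identityʳ k)) (Walk-inv w)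

HasRank⇒inv≡ : (p : Permutation′ (suc m)) {k : ℕ} → HasRank p k → inv p ≡ k
HasRank⇒inv≡ p (w , minimal) = ℕ.≤-antisym (proj₂ (HasRank-inv p) _ w) (minimal _ (proj₁ (HasRank-inv p)))

inv≡⇒HasRank : (p : Permutation′ (suc m)) {k : ℕ} → inv p ≡ k → HasRank p k
inv≡⇒HasRank p refl = HasRank-inv p

HasRank1⇒≈adj : (p : Permutation′ (suc m)) → HasRank p 1 → ∃[ i ] p ≈ adj i
HasRank1⇒≈adj p rank1 with inv≡suc⇒Descent p (HasRank⇒inv≡ p rank1)
... | i , d = i , λ k → trans (sym (swap-involutive i _)) (cong (swap i) (p∘adj≈id k))
  where
  p∘adj≈id : p ∘ₚ adj i ≈ id
  p∘adj≈id = inv≡0⇒≈id (p ∘ₚ adj i) (Descent⇒inv-pred i p d (HasRank⇒inv≡ p rank1))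

-- As long as the letters i and i + 1 are never exchanged, exchanging their
-- names turns a chain into a chain.
⪯-∘adj : (i : Fin m) {p q : Permutation′ (suc m)} → p ⪯ q → ¬ Descent i q →
         p ∘ₚ adj i ⪯ q ∘ₚ adj i
⪯-∘adj i ε ¬d = ε
⪯-∘adj i (inj₁ p≈s ◅ s⪯q) ¬d = inj₁ (λ l → cong (swap i) (p≈s l)) ◅ ⪯-∘adj i s⪯q ¬d
⪯-∘adj i {p} (_◅_ {j = s} (inj₂ p⋖s) s⪯q) ¬d with ⋖⇒adj p s p⋖s
... | k , a , s≈ = inj₂ (adj⇒⋖ k (p ∘ₚ adj i) (s ∘ₚ adj i)
    (swap-mono-< i a λ (e₁ , e₂) → ¬d (⪯-Descent i s⪯q (exchanged e₁ e₂)))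
    λ l → cong (swap i) (s≈ l)) ◅ ⪯-∘adj i s⪯q ¬d
  where
  exchanged : p ⟨$⟩ʳ inject₁ k ≡ inject₁ i → p ⟨$⟩ʳ suc k ≡ suc i → Descent i s
  exchanged e₁ e₂ = subst₂ _<_
    (trans (sym (inverseˡ s)) (cong (s ⟨$⟩ˡ_)
      (trans (s≈ _) (trans (cong (p ⟨$⟩ʳ_) (swap-inject₁ k)) e₂))))
    (trans (sym (inverseˡ s)) (cong (s ⟨$⟩ˡ_)
      (trans (s≈ _) (trans (cong (p ⟨$⟩ʳ_) (swap-suc k)) e₁))))
    (inject₁<suc k)

-- The chain from the identity to `q ∘ₚ adj i` ends without the descent `i`; multiplying all of it
-- by `adj i` gives a chain from `adj i` to `q`.
Descent⇒adj⪯ : (i : Fin m) (q : Permutation′ (suc m)) → Descent i q → adj i ⪯ q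
Descent⇒adj⪯ i q d = ≈⇒⪯ (adj i) (id ∘ₚ adj i) (λ _ → refl)
  ◅◅ ⪯-∘adj i (id⪯ (q ∘ₚ adj i)) (<-asym (∘adj-Ascent i q d))
  ◅◅ ≈⇒⪯ ((q ∘ₚ adj i) ∘ₚ adj i) q (∘adj-involutive i q)

adj⪯⇒Descent : (i : Fin m) {q : Permutation′ (suc m)} → adj i ⪯ q → Descent i q
adj⪯⇒Descent i adj⪯q = ⪯-Descent i adj⪯q (∘adj-Descent i id (inject₁<suc i))

-- If there were no common descent, a common lower bound would have no descents at all and be the
-- identity. The identity would then be the meet, of rank 0.
Intersecting⇒commonDescent : (P : Pred (Permutation′ (suc m)) 0ℓ) → Intersecting P →
  (x y : Permutation′ (suc m)) → P x → P y → ∃[ i ] Descent i x × Descent i y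
Intersecting⇒commonDescent P int x y Px Py with any? (λ i → Descent? i x ×-dec Descent? i y)
... | yes common = common
... | no ¬common = contradiction (int x y Px Py id (id⪯ x , id⪯ y , below)) λ (k , rank , 1≤k) →
  ℕ.<-irrefl refl (subst (1 ≤_) (trans (sym (HasRank⇒inv≡ id rank)) inv-id) 1≤k)
  where
  below : ∀ z → z ⪯ x → z ⪯ y → z ⪯ id
  below z z⪯x z⪯y with ≈id⊎Descent z
  ... | inj₁ z≈id = ≈⇒⪯ z id z≈id
  ... | inj₂ (i , d) = contradiction (i , ⪯-Descent i z⪯x d , ⪯-Descent i z⪯y d) ¬common

-- The atom `adj i` is a common lower bound of any two members, so their meet lies above it and has
-- the descent `i`.
star-Intersecting : (i : Fin m) (r : ℕ) → Intersecting (λ q → inv q ≡ r × Descent i q)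
star-Intersecting i r x y (_ , dx) (_ , dy) z (_ , _ , greatest) =
  inv z , HasRank-inv z , subst (1 ≤_) (sym (inv-Descent i z dz)) (s≤s z≤n)
  where
  dz = adj⪯⇒Descent i (greatest (adj i) (Descent⇒adj⪯ i x dx) (Descent⇒adj⪯ i y dy))

-- Counting in lists

private
  variable
    a ℓ : Level
    A B : Set a

module _ (S : Setoid a ℓ) where
  open Setoid S using () renaming (Carrier to C; _≈_ to _~_; trans to ~-trans; sym to ~-sym)
  open Membership S using (_∈_)
  open UniqueSetoid S using (Unique)

  lookup-injective : {xs : List C} → Unique xs → ∀ i j → lookup xs i ~ lookup xs j → i ≡ j
  lookup-injective (x∉ ∷ xs!) zero    zero    eq = refl
  lookup-injective {x ∷ xs} (x∉ ∷ xs!) zero    (suc j) eq =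
    contradiction eq (All.lookup x∉ (∈ₚ.∈-lookup j))
  lookup-injective {x ∷ xs} (x∉ ∷ xs!) (suc i) zero    eq =
    contradiction (~-sym eq) (All.lookup x∉ (∈ₚ.∈-lookup i))
  lookup-injective (x∉ ∷ xs!) (suc i) (suc j) eq = cong suc (lookup-injective xs! i j eq)

  -- Pigeonhole: sending each index of `xs` to the index of its entry in `ys` is injective, because
  -- `xs` has no repetitions.
  Unique-⊆⇒length≤ : {xs ys : List C} → Unique xs →
                     (∀ {x} → x ∈ xs → x ∈ ys) → length xs ≤ length ys
  Unique-⊆⇒length≤ {xs} {ys} xs! sub = injective⇒≤ {f = λ i → Any.index (mem i)} λ {i} {j} eq →
    lookup-injective xs! i j (∈ₛ.index-injective S (mem i) (mem j) eq)
    where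
    mem : ∀ i → lookup xs i ∈ ys
    mem i = sub (∈ₛ.∈-lookup S xs i)

length-filter-∁ : {P : Pred A ℓ} (P? : Decidable P) (xs : List A) →
                  length (filter P? xs) + length (filter (¬? ∘ P?) xs) ≡ length xs
length-filter-∁ P? [] = refl
length-filter-∁ P? (x ∷ xs) with P? x
... | yes _ = cong suc (length-filter-∁ P? xs)
... | no _  = trans (ℕ.+-suc _ _) (cong suc (length-filter-∁ P? xs))

length-concatMap-≤ : (f : A → List B) (c : ℕ) → (∀ x → length (f x) ≤ c) →
                     ∀ xs → length (concatMap f xs) ≤ length xs * c
length-concatMap-≤ f c f≤c []       = z≤n
length-concatMap-≤ f c f≤c (x ∷ xs) = subst (_≤ c + length xs * c) (sym (length-++ (f x)))
  (ℕ.+-mono-≤ (f≤c x) (length-concatMap-≤ f c f≤c xs))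

sumₗ-map-≤ : (f g : A → ℕ) (xs : List A) → (∀ {x} → x ∈ₚ.∈ xs → f x ≤ g x) →
             sumₗ (map f xs) ≤ sumₗ (map g xs)
sumₗ-map-≤ f g []       f≤g = z≤n
sumₗ-map-≤ f g (x ∷ xs) f≤g = ℕ.+-mono-≤ (f≤g (here refl)) (sumₗ-map-≤ f g xs (f≤g ∘ there))

sumₗ-map-const : (c : ℕ) (xs : List A) → sumₗ (map (λ _ → c) xs) ≡ length xs * c
sumₗ-map-const c []       = refl
sumₗ-map-const c (x ∷ xs) = cong (c +_) (sumₗ-map-const c xs)

double-counting : {R : A → B → Set ℓ} (R? : ∀ x y → Dec (R x y)) (xs : List A) (ys : List B) →
  sumₗ (map (λ x → length (filter (R? x) ys)) xs) ≡
  sumₗ (map (λ y → length (filter (λ x → R? x y) xs)) ys)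
double-counting R? xs [] = trans (sumₗ-map-const 0 xs) (ℕ.*-zeroʳ (length xs))
double-counting R? xs (y ∷ ys) = trans (add-row xs)
  (cong (length (filter (λ x → R? x y) xs) +_) (double-counting R? xs ys))
  where
  row : ∀ z → ℕ
  row z = length (filter (R? z) ys)
  add-row : ∀ zs → sumₗ (map (λ x → length (filter (R? x) (y ∷ ys))) zs) ≡
                   length (filter (λ x → R? x y) zs) + sumₗ (map row zs)
  add-row [] = refl
  add-row (z ∷ zs) with R? z y | trans (cong (row z +_) (add-row zs))
    (x∙yz≈y∙xz (row z) (length (filter (λ x → R? x y) zs)) _)
  ... | yes _ | eq = cong suc eq
  ... | no _  | eq = eq

-- The levels of the weak order

permDecSetoid : ℕ → DecSetoid 0ℓ 0ℓ
permDecSetoid n = record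
  { Carrier = Permutation′ n
  ; _≈_ = _≈_
  ; isDecEquivalence = record
    { isEquivalence = Setoid.isEquivalence (permSetoid n)
    ; _≟_ = λ p q → all? λ i → p ⟨$⟩ʳ i ≟ q ⟨$⟩ʳ i
    }
  }

module _ {m : ℕ} where

  private
    Perm : Set
    Perm = Permutation′ (suc m)

    S : Setoid 0ℓ 0ℓ
    S = permSetoid (suc m)

    inv-resp : ∀ {r} {p q : Perm} → p ≈ q → inv p ≡ r → inv q ≡ r
    inv-resp {p = p} {q} p≈q eq = trans (sym (inv-cong p q p≈q)) eq

    _≈?_ : (p q : Perm) → Dec (p ≈ q)
    _≈?_ = DecSetoid._≟_ (permDecSetoid (suc m))

  open Membership S using (_∈_)
  open UniqueSetoid S using (Unique)

  -- Products of r adjacent transpositions. The list may repeat permutations and contain some of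
  -- smaller rank, so `level` filters it by `inv` and removes duplicates.
  words : ℕ → List Perm
  words zero    = [ id ]
  words (suc r) = cartesianProductWith (λ i p → p ∘ₚ adj i) (allFin m) (words r)

  ∈-words : (r : ℕ) (p : Perm) → inv p ≡ r → p ∈ words r
  ∈-words zero    p eq = here (inv≡0⇒≈id p eq)
  ∈-words (suc r) p eq with inv≡suc⇒Descent p eq
  ... | i , d = ∈ₛ.∈-resp-≈ S {words (suc r)} {(p ∘ₚ adj i) ∘ₚ adj i} {p} (∘adj-involutive i p)
    (∈ₛ.∈-cartesianProductWith⁺ (setoid (Fin m)) S S {λ i p → p ∘ₚ adj i}
      (λ { {j} {_} {p} {q} refl → ∘adj-cong j p q })
      {allFin m} {words r} {i} {p ∘ₚ adj i} (∈ₚ.∈-allFin i)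
      (∈-words r (p ∘ₚ adj i) (Descent⇒inv-pred i p d eq)))

  level : ℕ → List Perm
  level r = deduplicate _≈?_ (filter (λ p → inv p ℕ.≟ r) (words r))

  level-unique : (r : ℕ) → Unique (level r)
  level-unique r = !ₛ.deduplicate-! (permDecSetoid (suc m)) (filter (λ p → inv p ℕ.≟ r) (words r))

  ∈-level⁺ : (r : ℕ) (p : Perm) → inv p ≡ r → p ∈ level r
  ∈-level⁺ r p eq = ∈ₛ.∈-deduplicate⁺ S _≈?_
    (λ {x} {y} {z} z≈y x≈y → Setoid.trans S {x} {y} {z} x≈y (Setoid.sym S {z} {y} z≈y))
    {filter (λ p → inv p ℕ.≟ r) (words r)} {p}
    (∈ₛ.∈-filter⁺ S (λ p → inv p ℕ.≟ r) (λ {x} {y} → inv-resp {r} {x} {y})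
      {p} {words r} (∈-words r p eq) eq)

  ∈-level⁻ : (r : ℕ) (p : Perm) → p ∈ level r → inv p ≡ r
  ∈-level⁻ r p p∈ = proj₂ (∈ₛ.∈-filter⁻ S (λ p → inv p ℕ.≟ r)
    (λ {x} {y} → inv-resp {r} {x} {y}) {p} {words r}
    (∈ₛ.∈-deduplicate⁻ S _≈?_ (filter (λ p → inv p ℕ.≟ r) (words r)) {p} p∈))

  star rising : Fin m → ℕ → List Perm
  star   i r = filter (Descent? i) (level r)
  rising i r = filter (¬? ∘ Descent? i) (level r)

  star-unique : (i : Fin m) (r : ℕ) → Unique (star i r)
  star-unique i r = !ₛ.filter⁺ S (Descent? i) (level-unique r)

  ∈-star⁺ : (i : Fin m) (r : ℕ) (p : Perm) → inv p ≡ r → Descent i p → p ∈ star i r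
  ∈-star⁺ i r p eq =
    ∈ₛ.∈-filter⁺ S (Descent? i) (λ {x} {y} → Descent-resp i {x} {y}) {p} {level r} (∈-level⁺ r p eq)

  ∈-star⁻ : (i : Fin m) (r : ℕ) (p : Perm) → p ∈ star i r → inv p ≡ r × Descent i p
  ∈-star⁻ i r p p∈ = Product.map₁ (∈-level⁻ r p)
    (∈ₛ.∈-filter⁻ S (Descent? i) (λ {x} {y} → Descent-resp i {x} {y}) {p} {level r} p∈)

  ∘adj-injective : (i : Fin m) (p q : Perm) → p ∘ₚ adj i ≈ q ∘ₚ adj i → p ≈ q
  ∘adj-injective i p q eq k = trans (sym (swap-involutive i _)) (trans (cong (swap i) (eq k)) (swap-involutive i _))

  ∘adj-length≤ : (i : Fin m) {xs ys : List Perm} → Unique xs →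
                 (∀ x → x ∈ xs → x ∘ₚ adj i ∈ ys) → length xs ≤ length ys
  ∘adj-length≤ i {xs} {ys} xs! sub = subst (_≤ length ys) (length-map (_∘ₚ adj i) xs)
    (Unique-⊆⇒length≤ S (!ₛ.map⁺ S S (λ {p} {q} → ∘adj-injective i p q) xs!) λ {y} y∈ →
      let x , x∈ , y≈ = ∈ₛ.∈-map⁻ S S {y} {xs} {_∘ₚ adj i} y∈ in
      ∈ₛ.∈-resp-≈ S {ys} {x ∘ₚ adj i} {y} (Setoid.sym S {y} {x ∘ₚ adj i} y≈) (sub x x∈))

  rising≤star : (i : Fin m) (r : ℕ) → length (rising i r) ≤ length (star i (suc r))
  rising≤star i r = ∘adj-length≤ i {rising i r} (!ₛ.filter⁺ S ¬Descent? (level-unique r)) λ x x∈ →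
    let x∈level , ¬d = ∈ₛ.∈-filter⁻ S ¬Descent?
          (λ {p} {q} → resp {p} {q}) {x} {level r} x∈
        asc = ¬Descent⇒Ascent i x ¬d
    in ∈-star⁺ i (suc r) (x ∘ₚ adj i)
         (trans (inv-∘adj i x asc) (cong suc (∈-level⁻ r x x∈level))) (∘adj-Descent i x asc)
    where
    ¬Descent? : Decidable (λ p → ¬ Descent i p)
    ¬Descent? = ¬? ∘ Descent? i
    resp : ∀ {p q} → p ≈ q → ¬ Descent i p → ¬ Descent i q
    resp {p} {q} p≈q ¬d d = ¬d (Descent-resp i {q} {p} (≈-sym {p = p} {q} p≈q) d)

  star≤level : (i : Fin m) (r : ℕ) → length (star i (suc r)) ≤ length (level r)
  star≤level i r = ∘adj-length≤ i (star-unique i (suc r)) λ x x∈ →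
    let eq , d = ∈-star⁻ i (suc r) x x∈ in
    ∈-level⁺ r (x ∘ₚ adj i) (Descent⇒inv-pred i x d eq)

  -- Descent counts and the growth of levels

  descents : Perm → List (Fin m)
  descents p = filter (λ i → Descent? i p) (allFin m)

  -- Undoing one descent `i` lowers `inv` by one and keeps all the others, so `descents p` is
  -- contained in `i` together with the descents of `p ∘ₚ adj i`.
  length-descents≤inv : (p : Perm) → length (descents p) ≤ inv p
  length-descents≤inv p = bound (inv p) p refl
    where
    descents-unique : ∀ p → UniqueSetoid.Unique (setoid (Fin m)) (descents p)
    descents-unique p = !.filter⁺ (λ i → Descent? i p) (!.allFin⁺ m)
    ∈-descents⁻ : ∀ p {j} → j ∈ₚ.∈ descents p → Descent j p
    ∈-descents⁻ p = proj₂ ∘ ∈ₚ.∈-filter⁻ (λ i → Descent? i p) {xs = allFin m}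
    bound : ∀ r p → inv p ≡ r → length (descents p) ≤ r
    bound zero p eq = Unique-⊆⇒length≤ (setoid (Fin m)) {descents p} {[]} (descents-unique p) λ {j} j∈ →
      contradiction (trans (sym eq) (inv-Descent j p (∈-descents⁻ p j∈))) λ ()
    bound (suc r) p eq with inv≡suc⇒Descent p eq
    ... | i , di = ℕ.≤-trans
      (Unique-⊆⇒length≤ (setoid (Fin m)) {descents p} {i ∷ descents (p ∘ₚ adj i)}
        (descents-unique p) split)
      (s≤s (bound r (p ∘ₚ adj i) (Descent⇒inv-pred i p di eq)))
      where
      split : ∀ {j} → j ∈ₚ.∈ descents p → j ∈ₚ.∈ (i ∷ descents (p ∘ₚ adj i))
      split {j} j∈ with j ≟ i
      ... | yes j≡i = here j≡i
      ... | no j≢i = there (∈ₚ.∈-filter⁺ (λ i′ → Descent? i′ (p ∘ₚ adj i)) (∈ₚ.∈-allFin j)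
        (∘adj-preserves-Descent i j p (j≢i ∘ sym) di (∈-descents⁻ p j∈)))

  -- Pairs of a member of level `k` and an ascent of it are regrouped by index, compared with the
  -- pairs of a member and a descent one level up, and regrouped by member again. Here `m` is n - 1,
  -- the number of atoms.
  level-growth : (k : ℕ) → (m ∸ k) * length (level k) ≤ suc k * length (level (suc k))
  level-growth k = begin
    (m ∸ k) * length (level k)
      ≡⟨ ℕ.*-comm (m ∸ k) _ ⟩
    length (level k) * (m ∸ k)
      ≡⟨ sumₗ-map-const (m ∸ k) (level k) ⟨
    sumₗ (map (λ _ → m ∸ k) (level k))
      ≤⟨ sumₗ-map-≤ _ _ (level k) many-ascents ⟩
    sumₗ (map (λ x → length (filter (λ i → ¬? (Descent? i x)) (allFin m))) (level k))
      ≡⟨ double-counting (λ i x → ¬? (Descent? i x)) (allFin m) (level k) ⟨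
    sumₗ (map (λ i → length (rising i k)) (allFin m))
      ≤⟨ sumₗ-map-≤ _ _ (allFin m) (λ {i} _ → rising≤star i k) ⟩
    sumₗ (map (λ i → length (star i (suc k))) (allFin m))
      ≡⟨ double-counting Descent? (allFin m) (level (suc k)) ⟩
    sumₗ (map (λ x → length (descents x)) (level (suc k)))
      ≤⟨ sumₗ-map-≤ _ _ (level (suc k)) (λ x∈ → few-descents (suc k) x∈) ⟩
    sumₗ (map (λ _ → suc k) (level (suc k)))
      ≡⟨ sumₗ-map-const (suc k) (level (suc k)) ⟩
    length (level (suc k)) * suc k
      ≡⟨ ℕ.*-comm _ (suc k) ⟩
    suc k * length (level (suc k)) ∎
    where
    open ℕ.≤-Reasoning
    few-descents : ∀ r {x} → x ∈ₚ.∈ level r → length (descents x) ≤ r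
    few-descents r {x} x∈ = subst (length (descents x) ≤_)
      (∈-level⁻ r x (Any.map (λ { refl _ → refl }) x∈)) (length-descents≤inv x)
    many-ascents : ∀ {x} → x ∈ₚ.∈ level k →
                   m ∸ k ≤ length (filter (λ i → ¬? (Descent? i x)) (allFin m))
    many-ascents {x} x∈ = begin
      m ∸ k       ≤⟨ ℕ.∸-monoʳ-≤ m (few-descents k x∈) ⟩
      m ∸ d       ≡⟨ cong (_∸ d) (trans (length-filter-∁ (λ i → Descent? i x) (allFin m))
                                        (length-tabulate {n = m} (λ i → i))) ⟨
      (d + _) ∸ d ≡⟨ ℕ.m+n∸m≡n d _ ⟩
      _           ∎
      where
      d = length (descents x)

  level-growth-* : (k c : ℕ) → suc k * c ≤ m ∸ k → c * length (level k) ≤ length (level (suc k))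
  level-growth-* k c large = ℕ.*-cancelˡ-≤ (suc k) (begin
    suc k * (c * length (level k)) ≡⟨ ℕ.*-assoc (suc k) c _ ⟨
    suc k * c * length (level k)   ≤⟨ ℕ.*-monoˡ-≤ _ large ⟩
    (m ∸ k) * length (level k)     ≤⟨ level-growth k ⟩
    suc k * length (level (suc k)) ∎)
    where open ℕ.≤-Reasoning

  -- Level k + 1 has at least c + 1 times the size of level `k`. Its members with the descent `i`
  -- use up at most one of these copies, and `adj i` carries the remaining members into the star one
  -- level up.
  star-large : (i : Fin m) (k c : ℕ) → suc k * suc c ≤ m ∸ k →
               c * length (level k) ≤ length (star i (suc (suc k)))
  star-large i k c large = ℕ.≤-trans (ℕ.+-cancelˡ-≤ (length (level k)) _ _ (begin
    suc c * length (level k)                        ≤⟨ level-growth-* k (suc c) large ⟩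
    length (level (suc k))                          ≡⟨ length-filter-∁ (Descent? i) (level (suc k)) ⟨
    length (star i (suc k)) + length (rising i (suc k)) ≤⟨ ℕ.+-monoˡ-≤ _ (star≤level i k) ⟩
    length (level k) + length (rising i (suc k))    ∎))
    (rising≤star i (suc k))
    where open ℕ.≤-Reasoning

  -- Intersecting families without a common descent

  inv-twoDescents : (i j : Fin m) (p : Perm) → i ≢ j → Descent i p → Descent j p →
                    inv p ≡ suc (suc (inv ((p ∘ₚ adj i) ∘ₚ adj j)))
  inv-twoDescents i j p i≢j di dj = trans (inv-Descent i p di)
    (cong suc (inv-Descent j (p ∘ₚ adj i) (∘adj-preserves-Descent i j p i≢j di dj)))

  PairwiseCommonDescent : List Perm → Set
  PairwiseCommonDescent xs = ∀ x y → x ∈ xs → y ∈ xs → ∃[ i ] Descent i x × Descent i y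

  Nontrivial : List Perm → Set
  Nontrivial xs = ∀ i → ∃[ y ] y ∈ xs × ¬ Descent i y

  -- The common descent of `x` and `y` cannot be `i`, since `y` was chosen to lack it.
  secondDescent : (xs : List Perm) → PairwiseCommonDescent xs → (nontrivial : Nontrivial xs) →
    (i : Fin m) (x : Perm) → x ∈ xs → ∃[ j ] i ≢ j × Descent j x × Descent j (proj₁ (nontrivial i))
  secondDescent xs common nontrivial i x x∈ with nontrivial i
  ... | y , y∈ , ¬di with common x y x∈ y∈
  ...   | j , djx , djy = j , (λ { refl → ¬di djy }) , djx , djy

  -- There are at most r choices of i in `descents x₁` and at most r of j in `descents (other i)`,
  -- while z ranges over level `k`. The permutations `above i j z` cover the family.
  nontrivial-bound : (k : ℕ) (xs : List Perm) → Unique xs → (∀ x → x ∈ xs → inv x ≡ suc (suc k)) →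
    PairwiseCommonDescent xs → Nontrivial xs → (x₁ : Perm) → x₁ ∈ xs →
    length xs ≤ suc (suc k) * (suc (suc k) * length (level k))
  nontrivial-bound k xs xs! rank common nontrivial x₁ x₁∈ = begin
    length xs
      ≤⟨ Unique-⊆⇒length≤ S xs! (λ {x} → cover x) ⟩
    length (concatMap through (descents x₁))
      ≤⟨ length-concatMap-≤ through _ through-length (descents x₁) ⟩
    length (descents x₁) * (r * L)
      ≤⟨ ℕ.*-monoˡ-≤ (r * L) (few-descents x₁ x₁∈) ⟩
    r * (r * L) ∎
    where
    open ℕ.≤-Reasoning
    r = suc (suc k)
    L = length (level k)
    other : Fin m → Perm
    other i = proj₁ (nontrivial i)
    few-descents : ∀ x → x ∈ xs → length (descents x) ≤ r
    few-descents x x∈ = subst (length (descents x) ≤_) (rank x x∈) (length-descents≤inv x)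
    above : Fin m → Fin m → Perm → Perm
    above i j z = (z ∘ₚ adj j) ∘ₚ adj i
    through : Fin m → List Perm
    through i = concatMap (λ j → map (above i j) (level k)) (descents (other i))
    through-length : ∀ i → length (through i) ≤ r * L
    through-length i = ℕ.≤-trans
      (length-concatMap-≤ _ L (λ j → ℕ.≤-reflexive (length-map (above i j) (level k))) (descents (other i)))
      (ℕ.*-monoˡ-≤ L (few-descents (other i) (proj₁ (proj₂ (nontrivial i)))))
    cover : ∀ x → x ∈ xs → x ∈ concatMap through (descents x₁)
    cover x x∈ =
      let i , dix₁ , dix = common x₁ x x₁∈ x∈
          j , i≢j , djx , djy = secondDescent xs common nontrivial i x x∈
          -- Since `j` is still a descent after `i` has been undone, the rank drops by exactly two.
          z = (x ∘ₚ adj i) ∘ₚ adj j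
          z∈ = ∈-level⁺ k z (ℕ.suc-injective (ℕ.suc-injective
            (trans (sym (inv-twoDescents i j x i≢j dix djx)) (rank x x∈))))
          above-z≈x : above i j z ≈ x
          above-z≈x l = trans (cong (swap i) (swap-involutive j _)) (swap-involutive i _)
          x∈map = ∈ₛ.∈-resp-≈ S {map (above i j) (level k)} {above i j z} {x} above-z≈x
            (∈ₛ.∈-map⁺ S S {above i j}
              (λ {p} {q} p≈q → ∘adj-cong i (p ∘ₚ adj j) (q ∘ₚ adj j) (∘adj-cong j p q p≈q))
              {z} {level k} z∈)
      in ∈ₛ.∈-concatMap⁺ (setoid (Fin m)) S {through} {descents x₁} {x}
           (∈ₚ.lose (∈ₚ.∈-filter⁺ (λ i → Descent? i x₁) (∈ₚ.∈-allFin i) dix₁)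
             (∈ₛ.∈-concatMap⁺ (setoid (Fin m)) S
               {λ j → map (above i j) (level k)} {descents (other i)} {x}
               (∈ₚ.lose (∈ₚ.∈-filter⁺ (λ j → Descent? j (other i)) (∈ₚ.∈-allFin j) djy)
                 x∈map)))

  -- Indices and members are finite in number, so the distinction is decidable, and failure of the
  -- first case produces an explicit `y` for every `i`.
  common⊎Nontrivial : (xs : List Perm) → (∃[ i ] (∀ x → x ∈ xs → Descent i x)) ⊎ Nontrivial xs
  common⊎Nontrivial xs with any? (λ i → All.all? (Descent? i) xs)
  ... | yes (i , all) = inj₁ (i , λ x x∈ →
    let y , y∈ , x≈y = ∈ₚ.find x∈ in
    Descent-resp i {y} {x} (≈-sym {p = x} {y} x≈y) (All.lookup all y∈))
  ... | no ¬all = inj₂ λ i →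
    let y , y∈ , ¬d = ∈ₚ.find (¬All⇒Any¬ (Descent? i) xs λ all → ¬all (i , all)) in
    y , Any.map (λ { refl _ → refl }) y∈ , ¬d

  nontrivial≤star : (i : Fin m) (r : ℕ) → suc r + suc r * suc (suc r * suc r) ≤ m →
    (xs : List Perm) → Unique xs → (∀ x → x ∈ xs → inv x ≡ suc r) →
    PairwiseCommonDescent xs → Nontrivial xs → (x₁ : Perm) → x₁ ∈ xs →
    length xs ≤ length (star i (suc r))
  -- There is no level two below rank 1. Here two distinct descents would force rank at least 2, so
  -- the family cannot have a member.
  nontrivial≤star i zero large xs xs! rank common nontrivial x₁ x₁∈ =
    let i , di , _ = common x₁ x₁ x₁∈ x₁∈
        j , i≢j , dj , _ = secondDescent xs common nontrivial i x₁ x₁∈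
    in contradiction (trans (sym (rank x₁ x₁∈)) (inv-twoDescents i j x₁ i≢j di dj)) λ ()
  nontrivial≤star i (suc k) large xs xs! rank common nontrivial x₁ x₁∈ = begin
    length xs                          ≤⟨ nontrivial-bound k xs xs! rank common nontrivial x₁ x₁∈ ⟩
    r * (r * length (level k))         ≡⟨ ℕ.*-assoc r r (length (level k)) ⟨
    r * r * length (level k)           ≤⟨ star-large i k (r * r) (ℕ.m+n≤o⇒m≤o∸n _ enough) ⟩
    length (star i r)                  ∎
    where
    open ℕ.≤-Reasoning
    r = suc (suc k)
    enough : suc k * suc (r * r) + k ≤ m
    -- `star-large` with `c` equal to `r * r` asks for (k + 1)(r² + 1) ≤ m - k. Rounding `k` and
    -- `suc k` up to `r` turns this into the bound r + r(r² + 1) ≤ m given by `large`.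
    enough = begin
      suc k * suc (r * r) + k ≡⟨ ℕ.+-comm _ k ⟩
      k + suc k * suc (r * r)
        ≤⟨ ℕ.+-mono-≤ (ℕ.m≤n+m k 2) (ℕ.*-monoˡ-≤ (suc (r * r)) (ℕ.n≤1+n (suc k))) ⟩
      r + r * suc (r * r)     ≤⟨ large ⟩
      m                       ∎

  family≤star : (i₀ : Fin m) (r : ℕ) → suc r + suc r * suc (suc r * suc r) ≤ m →
    (xs : List Perm) → Unique xs → (∀ x → x ∈ xs → inv x ≡ suc r) → PairwiseCommonDescent xs →
    ∃[ i ] length xs ≤ length (star i (suc r))
  family≤star i₀ r large [] xs! rank common = i₀ , z≤n
  family≤star i₀ r large xs@(x₁ ∷ _) xs! rank common with common⊎Nontrivial xs
  ... | inj₁ (i , all) = i , Unique-⊆⇒length≤ S xs! λ {x} x∈ →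
    ∈-star⁺ i (suc r) x (rank x x∈) (all x x∈)
  -- Every star is at least as large as a nontrivial family, so any index serves.
  ... | inj₂ nontrivial = i₀ ,
    nontrivial≤star i₀ r large xs xs! rank common nontrivial x₁ (here λ _ → refl)

  -- Maximum stars and the EKR property

  star-HasSize : (i : Fin m) (r : ℕ) → HasSize (λ q → inv q ≡ r × Descent i q) (length (star i r))
  star-HasSize i r = star i r , star-unique i r ,
    (λ q → mk⇔ (λ (eq , d) → ∈-star⁺ i r q eq d) (∈-star⁻ i r q)) , refl

  -- The list is the one that counts the descent family in `star-HasSize`; this is why both maxima
  -- in `level-isEKR` are the same number.
  adj-star-HasSize : (i : Fin m) (r : ℕ) → HasSize (λ q → HasRank q r × adj i ⪯ q) (length (star i r))
  adj-star-HasSize i r = star i r , star-unique i r ,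
    (λ q → mk⇔ (λ (rank , adj⪯q) → ∈-star⁺ i r q (HasRank⇒inv≡ q rank) (adj⪯⇒Descent i adj⪯q))
               (λ q∈ → Product.map (inv≡⇒HasRank q) (Descent⇒adj⪯ i q) (∈-star⁻ i r q q∈))) , refl

  star-size : (r : ℕ) {k : ℕ} → StarSize (suc m) r k → ∃[ i ] k ≤ length (star i r)
  star-size r (p , rank1 , xs , xs! , mem , refl) with HasRank1⇒≈adj p rank1
  ... | i , p≈adj = i , Unique-⊆⇒length≤ S xs! λ {q} q∈ →
    let rank , p⪯q = Equivalence.from (mem q) q∈ in
    ∈-star⁺ i r q (HasRank⇒inv≡ q rank)
      (adj⪯⇒Descent i (≈⇒⪯ (adj i) p (Setoid.sym S {p} {adj i} p≈adj) ◅◅ p⪯q))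

  level-isEKR : (i₀ : Fin m) (r : ℕ) → suc r + suc r * suc (suc r * suc r) ≤ m → IsEKR (suc m) (suc r)
  level-isEKR i₀ r large = size best , (family , family-max) , (stars , stars-max)
    where
    size : Fin m → ℕ
    size i = length (star i (suc r))
    best : Fin m
    -- `argmax` needs a default, supplied by `i₀`. As `allFin m` lists every index, the result is a
    -- maximum over all stars.
    best = argmax size i₀ (allFin m)
    size≤ : ∀ i → size i ≤ size best
    size≤ i = All.lookup (f[xs]≤f[argmax] {f = size} i₀ (allFin m)) (∈ₚ.∈-allFin i)
    family : IntersectingSize (suc m) (suc r) (size best)
    family = (λ q → inv q ≡ suc r × Descent best q) , (λ {q} (eq , _) → inv≡⇒HasRank q eq) ,
      star-Intersecting best (suc r) , star-HasSize best (suc r)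
    family-max : ∀ k → IntersectingSize (suc m) (suc r) k → k ≤ size best
    family-max _ (P , P⊆ , int , xs , xs! , mem , refl) =
      let i , le = family≤star i₀ r large xs xs!
            (λ x x∈ → HasRank⇒inv≡ x (P⊆ (∈P x x∈)))
            (λ x y x∈ y∈ → Intersecting⇒commonDescent P int x y (∈P x x∈) (∈P y y∈))
      in ℕ.≤-trans le (size≤ i)
      where
      ∈P : ∀ x → x ∈ xs → P x
      ∈P x = Equivalence.from (mem x)
    stars-max : ∀ k → StarSize (suc m) (suc r) k → k ≤ size best
    stars-max k k∈ = let i , le = star-size (suc r) k∈ in ℕ.≤-trans le (size≤ i)
    stars : StarSize (suc m) (suc r) (size best)
    stars = adj best , inv≡⇒HasRank (adj best) (inv-adj best) , adj-star-HasSize best (suc r)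

theorem5p8 : ∀ (r : ℕ) → 1 ≤ r → ∃[ n₀ ] (∀ (n : ℕ) → n₀ ≤ n → IsEKR n r)
-- The outer `suc` passes from the bound on n - 1 in `level-isEKR` to one on n. The threshold forces
-- n ≥ 2, so the index `zero` of an adjacent transposition exists.
theorem5p8 (suc r) _ = suc (suc r + suc r * suc (suc r * suc r)) ,
  λ { (suc (suc m)) (s≤s large) → level-isEKR zero r large }
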